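{- Let $G$ be an interval graph that has a pairing dominating set. Then $G$ has a pairing dominating set whose pairs are adjacent.
   Context: All graphs are finite and simple; $N[v]$ denotes the closed neighborhood of $v$. An interval graph is the intersection graph of a family of closed intervals of the real line: each vertex corresponds to an interval, and two vertices are adjacent if and only if their intervals intersect. A pairing dominating set of a graph $G=(V,E)$ is a set of pairs of vertices $\{(u_1,v_1),\dots,(u_k,v_k)\}$ of $V$ such that all the vertices appearing in the pairs are distinct and $V=\bigcup_{i=1}^k \left(N[u_i]\cap N[v_i]\right)$. Its pairs are adjacent if $u_iv_i\in E$ for every $i$. -}

module Defs where

open import Data.Fin using (Fin)
open import Data.Nat using (ℕ)
open import Data.Product using (Σ-syntax; ∃-syntax; _×_)
open import Data.Rational using (ℚ; _<_)
open import Data.Sum using (_⊎_; [_,_]′)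
open import Function.Bundles using (_⇔_)
open import Function.Definitions using (Injective)
open import Level using (0ℓ)
open import Relation.Binary.Core using (Rel)
open import Relation.Binary.Definitions using (Decidable; Irreflexive; Symmetric)
open import Relation.Binary.PropositionalEquality using (_≡_; _≢_)
open import Relation.Nullary using (¬_)
open import Relation.Unary using (Pred; _∈_; _⊆_; _∩_; _≬_; Satisfiable; ⋃)

-- Real numbers as two-sided Dedekind cuts of ℚ: q ∈ L means q < x and
-- q ∈ U means x < q.
record ℝ : Set₁ where
  field
    L U         : Pred ℚ 0ℓ
    L-inhabited : Satisfiable L
    U-inhabited : Satisfiable U
    L-rounded   : ∀ q → q ∈ L ⇔ (∃[ r ] q < r × r ∈ L)
    U-rounded   : ∀ q → q ∈ U ⇔ (∃[ r ] r < q × r ∈ U)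
    disjoint    : ∀ q → ¬ (q ∈ L × q ∈ U)
    located     : ∀ q r → q < r → q ∈ L ⊎ r ∈ U

infix 4 _≤ᴿ_

_≤ᴿ_ : ℝ → ℝ → Set
x ≤ᴿ y = ℝ.L x ⊆ ℝ.L y

record ClosedInterval : Set₁ where
  field
    lo hi : ℝ
    lo≤hi : lo ≤ᴿ hi

points : ClosedInterval → Pred ℝ 0ℓ
points I x = (lo ≤ᴿ x) × (x ≤ᴿ hi)
  where open ClosedInterval I

record Graph : Set₁ where
  field
    order      : ℕ
    Adj        : Rel (Fin order) 0ℓ
    Adj-sym    : Symmetric Adj
    Adj-irrefl : Irreflexive _≡_ Adj
    Adj?       : Decidable Adj

  V : Set
  V = Fin order

  N[_] : V → Pred V 0ℓ
  N[ v ] w = w ≡ v ⊎ Adj v w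

-- P ≬ Q says that P and Q have a common element. Distinct vertices may be
-- assigned the same interval.
IsIntervalGraph : Graph → Set₁
IsIntervalGraph G =
  Σ[ I ∈ (V → ClosedInterval) ]
    (∀ u v → u ≢ v → Adj u v ⇔ (points (I u) ≬ points (I v)))
  where open Graph G

record PairingDominatingSet (G : Graph) : Set where
  open Graph G
  field
    size       : ℕ
    left right : Fin size → V
    -- The 2·size vertices left i, right j are pairwise distinct.
    distinct   : Injective _≡_ _≡_ [ left , right ]′
    dominating : ∀ w → w ∈ ⋃ (Fin size) (λ i → N[ left i ] ∩ N[ right i ])

HasAdjacentPairs : (G : Graph) → PairingDominatingSet G → Set
HasAdjacentPairs G D = ∀ i → Adj (left i) (right i)
  where
  open Graph G
  open PairingDominatingSet D

{-# OPTIONS --safe #-}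
module Submission where

-- Write u ≺ v when the interval of u lies to the left of that of v. Let {a, b}
-- be a pair with a ≺ b. If no vertex depends on it alone, the pair is dropped.
-- Otherwise let x be a vertex covered by {a, b} only; then x contains the gap
-- between a and b, and {a, x} covers all that {a, b} covers. If x is free, it
-- replaces b. Otherwise x and its mate x′ are not adjacent, say x ≺ x′, and
-- {a, b}, {x, x′} are exchanged for {a, x}, {b, x′}. In each case there are
-- fewer nonadjacent pairs. The exchange fails only when x reaches beyond b. One
-- then passes from {a, b} to {x, x′}, and it turns out that from there on the
-- failures are all on the right, so that this stops after finitely many steps.

open import Data.Empty using (⊥-elim)
open import Data.Fin using (Fin; zero; suc; _<_; _<?_; _≟_; combine; remQuot)
open import Data.Fin.Induction using (spo-noetherian)
open import Data.Fin.Permutation.Components using (transpose)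
open import Data.Fin.Properties
  using (any?; all?; sequence; remQuot-combine; <-asym; <-cmp; <⇒≢)
open import Data.Fin.Subset using (Subset; ⊤; _⊂_) renaming (_∈_ to _∈ˢ_)
open import Data.Fin.Subset.Induction using (⊂-wellFounded)
open import Data.Fin.Subset.Properties
  using (_∈?_; anySubset?; ∈⊤; x∈p⇒p-x⊂p; x∈p∧x≢y⇒x∈p-y)
open import Data.List using (List; _∷_; filter; allFin; length; lookup)
open import Data.List.Membership.Propositional using () renaming (_∈_ to _∈ᴸ_)
open import Data.List.Membership.Propositional.Properties using (∈-allFin; ∈-filter⁺; ∈-filter⁻; ∈-lookup)
import Data.List.Relation.Unary.All as All
open import Data.List.Relation.Unary.AllPairs using (_∷_)
open import Data.List.Relation.Unary.Any using (index)
open import Data.List.Relation.Unary.Any.Properties using (lookup-index)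
open import Data.List.Relation.Unary.Unique.Propositional using (Unique)
open import Data.List.Relation.Unary.Unique.Propositional.Properties using (filter⁺; allFin⁺)
open import Data.Nat using () renaming (_*_ to _ℕ*_)
open import Data.Product using (∃; ∃-syntax; _×_; _,_; proj₁; proj₂)
open import Data.Rational.Properties using () renaming (<-cmp to <ℚ-cmp)
open import Data.Sum using (_⊎_; inj₁; inj₂; [_,_]′; swap)
open import Data.Sum.Properties using (swap-involutive)
open import Data.Vec using (tabulate)
open import Data.Vec.Properties using (lookup∘tabulate; []=⇒lookup; lookup⇒[]=)
open import Effect.Monad using (RawMonad)
open import Function using (flip; _∘_; case_of_)
open import Function.Bundles using (Equivalence)
open import Induction.WellFounded using (Acc; acc)
open import Level using (0ℓ)
open import Relation.Binary.Core using (Rel)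
open import Relation.Binary.Definitions using (Decidable; Transitive; tri<; tri≈; tri>)
open import Relation.Binary.PropositionalEquality
open import Relation.Binary.Structures using (IsStrictPartialOrder)
open import Relation.Nullary using (¬_; Dec; yes; no; does; contradiction)
open import Relation.Nullary.Decidable
  using ( map′; ¬?; _×-dec_; _⊎-dec_; _→-dec_; decidable-stable; dec-true; dec-false
        ; ¬¬-excluded-middle)
open import Relation.Nullary.Negation using (¬¬-Monad; ¬¬-map)
open import Relation.Unary using (_∈_)
open import Defs

-- Transpositions and duplicate-free lists

transpose-first : ∀ {n} (i j : Fin n) → transpose i j i ≡ j
transpose-first i j rewrite dec-true (i ≟ i) refl = refl

transpose-second : ∀ {n} (i j : Fin n) → transpose i j j ≡ i
transpose-second i j with j ≟ i
... | yes j≡i = j≡i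
... | no _ rewrite dec-true (j ≟ j) refl = refl

transpose-other : ∀ {n} (i j : Fin n) {k} → k ≢ i → k ≢ j → transpose i j k ≡ k
transpose-other i j {k} k≢i k≢j
  rewrite dec-false (k ≟ i) k≢i | dec-false (k ≟ j) k≢j = refl

transpose-involutive : ∀ {n} (i j k : Fin n) → transpose i j (transpose i j k) ≡ k
transpose-involutive i j k with k ≟ i
... | yes refl = transpose-second k j
... | no k≢i with k ≟ j
...   | yes refl = transpose-first i k
...   | no k≢j = transpose-other i j k≢i k≢j

lookup-injective : ∀ {A : Set} {xs : List A} → Unique xs →
                   ∀ i j → lookup xs i ≡ lookup xs j → i ≡ j
lookup-injective (_ ∷ _)   zero    zero    _  = refl
lookup-injective (x∉ ∷ _)  zero    (suc j) eq = contradiction eq (All.lookup x∉ (∈-lookup j))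
lookup-injective (x∉ ∷ _)  (suc i) zero    eq = contradiction (sym eq) (All.lookup x∉ (∈-lookup i))
lookup-injective (_ ∷ xs!) (suc i) (suc j) eq = cong suc (lookup-injective xs! i j eq)

-- Closed adjacency and abstract interval orders (orders without 2+2)

module _ (G : Graph) where
  open Graph G

  infix 4 _∼_ _∼?_

  _∼_ : Rel V 0ℓ
  u ∼ v = v ∈ N[ u ]

  _∼?_ : Decidable _∼_
  u ∼? v = (v ≟ u) ⊎-dec Adj? u v

  ∼-refl : ∀ {u} → u ∼ u
  ∼-refl = inj₁ refl

  ∼-sym : ∀ {u v} → u ∼ v → v ∼ u
  ∼-sym (inj₁ eq) = inj₁ (sym eq)
  ∼-sym (inj₂ a)  = inj₂ (Adj-sym a)

  -- u ≺ v says that the interval of u lies entirely to the left of that of v.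
  record IntervalOrder : Set₁ where
    infix 4 _≺_
    field
      _≺_         : Rel V 0ℓ
      ≺⇒≁         : ∀ {u v} → u ≺ v → ¬ u ∼ v
      ≁⇒≺⊎≻       : ∀ {u v} → ¬ u ∼ v → u ≺ v ⊎ v ≺ u
      interchange : ∀ {a b c d} → a ≺ b → c ≺ d → a ≺ d ⊎ c ≺ b

    ≺⇒≁′ : ∀ {u v} → u ≺ v → ¬ v ∼ u
    ≺⇒≁′ u≺v = ≺⇒≁ u≺v ∘ ∼-sym

    ≺⇒≢ : ∀ {u v} → u ≺ v → u ≢ v
    ≺⇒≢ u≺v refl = ≺⇒≁ u≺v ∼-refl

    ≺-trans : Transitive _≺_
    ≺-trans u≺v v≺w with interchange u≺v v≺w
    ... | inj₁ u≺w = u≺w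
    ... | inj₂ v≺v = contradiction ∼-refl (≺⇒≁ v≺v)

    ≺-isStrictPartialOrder : IsStrictPartialOrder _≡_ _≺_
    ≺-isStrictPartialOrder = record
      { isEquivalence = isEquivalence
      ; irrefl        = λ u≡v u≺v → ≺⇒≢ u≺v u≡v
      ; trans         = ≺-trans
      ; <-resp-≈      = resp₂ _≺_
      }

    ≺-noetherian : ∀ v → Acc (flip _≺_) v
    ≺-noetherian = spo-noetherian ≺-isStrictPartialOrder

    -- x contains the gap between a and b.
    between : ∀ {a b x w} → a ≺ b → x ∼ a → x ∼ b → w ∼ a → w ∼ b → w ∼ x
    between {x = x} {w} a≺b x∼a x∼b w∼a w∼b = decidable-stable (w ∼? x) λ w≁x →
      case ≁⇒≺⊎≻ w≁x of λ where
        (inj₁ w≺x) → [ (λ w≺b → ≺⇒≁ w≺b w∼b) , (λ a≺x → ≺⇒≁′ a≺x x∼a) ]′ (interchange w≺x a≺b)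
        (inj₂ x≺w) → [ (λ x≺b → ≺⇒≁ x≺b x∼b) , (λ a≺w → ≺⇒≁′ a≺w w∼a) ]′ (interchange x≺w a≺b)

    -- x extends from the left of a up to b.
    absorb : ∀ {a b w x c} → a ≺ b → x ∼ b → w ≺ a → w ∼ x → a ∼ c → x ∼ c
    absorb {x = x} {c} a≺b x∼b w≺a w∼x a∼c = decidable-stable (x ∼? c) λ x≁c →
      case ≁⇒≺⊎≻ x≁c of λ where
        (inj₁ x≺c) → [ (λ x≺b → ≺⇒≁ x≺b x∼b) , (λ a≺c → ≺⇒≁ a≺c a∼c) ]′ (interchange x≺c a≺b)
        (inj₂ c≺x) → [ (λ c≺a → ≺⇒≁′ c≺a a∼c) , (λ w≺x → ≺⇒≁ w≺x w∼x) ]′ (interchange c≺x w≺a)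

  -- Mirroring the line lets each argument be given in one direction only.
  opposite : IntervalOrder → IntervalOrder
  opposite O = record
    { _≺_         = flip _≺_
    ; ≺⇒≁         = ≺⇒≁′
    ; ≁⇒≺⊎≻       = swap ∘ ≁⇒≺⊎≻
    ; interchange = λ b≺a d≺c → swap (interchange b≺a d≺c)
    }
    where open IntervalOrder O

  -- Pairings as involutions

  Covers : (V → V) → V → V → Set
  Covers m t w = m t ≢ t × w ∼ t × w ∼ m t

  covers? : ∀ m t w → Dec (Covers m t w)
  covers? m t w = ¬? (m t ≟ t) ×-dec (w ∼? t) ×-dec (w ∼? m t)

  -- The vertices outside all pairs are the fixed points of the involution.
  record Pairing : Set where
    field
      mate       : V → V
      involutive : ∀ v → mate (mate v) ≡ v
      dominates  : ∀ w → ∃[ t ] Covers mate t w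

    mate-≡ : ∀ {u v} → mate u ≡ v → mate v ≡ u
    mate-≡ {u} refl = involutive u

    mate-injective : ∀ {u v} → mate u ≡ mate v → u ≡ v
    mate-injective {u} {v} eq = trans (sym (involutive u)) (mate-≡ (sym eq))

    Nonadjacent : V → Set
    Nonadjacent t = ¬ t ∼ mate t

    -- The last clause allows both `a` and `b` because each pair covers through either of its ends.
    Essential : V → V → V → Set
    Essential a b x = x ∼ a × x ∼ b × (∀ t → Covers mate t x → t ≡ a ⊎ t ≡ b)

    essential? : ∀ a b x → Dec (Essential a b x)
    essential? a b x = (x ∼? a) ×-dec (x ∼? b) ×-dec
      all? λ t → covers? mate t x →-dec ((t ≟ a) ⊎-dec (t ≟ b))

  -- Two moves that improve a pairing

  open Pairing

  -- The measure is the set of vertices in nonadjacent pairs: no vertex enters it, and `a` leaves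
  -- it.
  Improvement : Pairing → Set
  Improvement p = ∃[ p′ ] (∀ {t} → Nonadjacent p′ t → Nonadjacent p t)
                × ∃[ a ] Nonadjacent p a × a ∼ mate p′ a

  -- Composing the involution with the transposition of `a` and its mate makes both fixed points and
  -- changes nothing else.
  drop-pair : ∀ p {a} → Nonadjacent p a → (∀ w → ¬ Essential p a (mate p a) w) → Improvement p
  drop-pair p {a} a≁b inessential =
    record { mate = m′ ; involutive = m′-involutive ; dominates = dominates′ } ,
    (λ {t} bad → nonadj t bad) , a , a≁b , subst (a ∼_) (sym m′a) ∼-refl
    where
    m = mate p
    b = m a
    m′ : V → V
    m′ t = transpose a b (m t)
    m′a : m′ a ≡ a
    m′a = transpose-second a b
    m′b : m′ b ≡ b
    m′b = trans (cong (transpose a b) (involutive p a)) (transpose-first a b)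
    m′-other : ∀ {t} → t ≢ a → t ≢ b → m′ t ≡ m t
    m′-other t≢a t≢b =
      transpose-other a b (t≢b ∘ sym ∘ mate-≡ p) (t≢a ∘ mate-injective p)
    m′-involutive : ∀ t → m′ (m′ t) ≡ t
    m′-involutive t with t ≟ a | t ≟ b
    ... | yes refl | _        = trans (cong m′ m′a) m′a
    ... | no _     | yes refl = trans (cong m′ m′b) m′b
    ... | no t≢a   | no t≢b   = trans (cong m′ (m′-other t≢a t≢b))
      (trans (cong (transpose a b) (involutive p t)) (transpose-other a b t≢a t≢b))
    nonadj : ∀ t → ¬ t ∼ m′ t → ¬ t ∼ m t
    nonadj t bad with t ≟ a | t ≟ b
    ... | yes refl | _        = a≁b
    ... | no _     | yes refl = contradiction (inj₁ m′b) bad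
    ... | no t≢a   | no t≢b   = bad ∘ subst (t ∼_) (sym (m′-other t≢a t≢b))
    cover : ∀ {t w} → t ≢ a → t ≢ b → Covers m t w → Covers m′ t w
    cover t≢a t≢b = subst (λ s → s ≢ _ × _ ∼ _ × _ ∼ s) (sym (m′-other t≢a t≢b))
    other : ∀ w → w ∼ a → w ∼ b → ∃[ t ] Covers m′ t w
    other w w∼a w∼b with any? (λ t → ¬? (t ≟ a) ×-dec ¬? (t ≟ b) ×-dec covers? m t w)
    ... | yes (t , t≢a , t≢b , c) = t , cover t≢a t≢b c
    ... | no none = contradiction
      (w∼a , w∼b , λ t c → decidable-stable ((t ≟ a) ⊎-dec (t ≟ b))
        λ t∉ → none (t , t∉ ∘ inj₁ , t∉ ∘ inj₂ , c))
      (inessential w)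
    dominates′ : ∀ w → ∃[ t ] Covers m′ t w
    dominates′ w with dominates p w
    ... | t , c@(_ , w∼t , w∼mt) with t ≟ a | t ≟ b
    ...   | yes refl | _        = other w w∼t w∼mt
    ...   | no _     | yes refl = other w (subst (w ∼_) (involutive p a) w∼mt) w∼t
    ...   | no t≢a   | no t≢b   = t , cover t≢a t≢b c

  -- Conjugating with the transposition of b and x turns the pairs {a, b} and
  -- {x, mate x} into {a, x} and {b, mate x}, and frees b when x was free.
  exchange : ∀ p {a x} → let b = mate p a in
             Nonadjacent p a → x ∼ a → x ∼ b →
             mate p x ≡ x ⊎ Nonadjacent p x →
             (∀ {w} → w ∼ a → w ∼ b → w ∼ x) →
             (∀ {w} → mate p x ≢ x → w ∼ x → w ∼ mate p x → w ∼ b) →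
             Improvement p
  exchange p {a} {x} a≁b x∼a x∼b x-free⊎bad via-x via-b =
    record { mate = m′ ; involutive = m′-involutive ; dominates = dominates′ } ,
    (λ {t} bad → nonadj t bad) , a , a≁b , subst (a ∼_) (sym m′a) (∼-sym x∼a)
    where
    m = mate p
    b = m a
    τ : V → V
    τ = transpose b x
    m′ : V → V
    m′ t = τ (m (τ t))
    a≢b : a ≢ b
    a≢b a≡b = a≁b (inj₁ (sym a≡b))
    x≢a : x ≢ a
    x≢a refl = a≁b x∼b
    x≢b : x ≢ b
    x≢b refl = a≁b (∼-sym x∼a)
    m′-involutive : ∀ t → m′ (m′ t) ≡ t
    m′-involutive t = begin
      τ (m (τ (τ (m (τ t))))) ≡⟨ cong (τ ∘ m) (transpose-involutive b x _) ⟩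
      τ (m (m (τ t)))         ≡⟨ cong τ (involutive p _) ⟩
      τ (τ t)                 ≡⟨ transpose-involutive b x t ⟩
      t                       ∎
      where open ≡-Reasoning
    m′a : m′ a ≡ x
    m′a = trans (cong (τ ∘ m) (transpose-other b x a≢b (x≢a ∘ sym))) (transpose-first b x)
    m′x : m′ x ≡ a
    m′x = trans (cong m′ (sym m′a)) (m′-involutive a)
    m′b : m x ≢ x → m′ b ≡ m x
    m′b mx≢x = trans (cong (τ ∘ m) (transpose-first b x))
      (transpose-other b x (x≢a ∘ mate-injective p) mx≢x)
    m′-other : ∀ {t} → t ≢ a → t ≢ b → t ≢ x → t ≢ m x → m′ t ≡ m t
    m′-other t≢a t≢b t≢x t≢mx = trans (cong (τ ∘ m) (transpose-other b x t≢b t≢x))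
      (transpose-other b x (t≢a ∘ mate-injective p) (t≢mx ∘ sym ∘ mate-≡ p))
    -- The pair of `b` and `m x` may be nonadjacent, but both vertices were in nonadjacent pairs
    -- before; the pair `{a, x}` is adjacent.
    nonadj : ∀ t → ¬ t ∼ m′ t → ¬ t ∼ m t
    nonadj t bad = go (t ≟ a) (t ≟ b) (t ≟ x) (t ≟ m x)
      where
      go : Dec (t ≡ a) → Dec (t ≡ b) → Dec (t ≡ x) → Dec (t ≡ m x) → ¬ t ∼ m t
      go (yes refl) _ _ _ = a≁b
      go _ (yes refl) _ _ = a≁b ∘ ∼-sym ∘ subst (b ∼_) (involutive p a)
      go _ _ (yes refl) _ = contradiction (subst (x ∼_) (sym m′x) x∼a) bad
      go _ _ (no t≢x) (yes refl) =
        [ (λ mx≡x → contradiction mx≡x t≢x)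
        , (λ x≁mx → x≁mx ∘ ∼-sym ∘ subst (m x ∼_) (involutive p x))
        ]′ x-free⊎bad
      go (no t≢a) (no t≢b) (no t≢x) (no t≢mx) =
        bad ∘ subst (t ∼_) (sym (m′-other t≢a t≢b t≢x t≢mx))
    via-ax : ∀ {w} → w ∼ a → w ∼ b → ∃[ t ] Covers m′ t w
    via-ax w∼a w∼b = a , subst (λ s → s ≢ a × _ ∼ a × _ ∼ s) (sym m′a) (x≢a , w∼a , via-x w∼a w∼b)
    via-bx′ : ∀ {w} → m x ≢ x → w ∼ x → w ∼ m x → ∃[ t ] Covers m′ t w
    via-bx′ mx≢x w∼x w∼mx = b , subst (λ s → s ≢ b × _ ∼ b × _ ∼ s) (sym (m′b mx≢x))
      ((x≢a ∘ mate-injective p) , via-b mx≢x w∼x w∼mx , w∼mx)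
    dominates′ : ∀ w → ∃[ t ] Covers m′ t w
    dominates′ w = let t , c = dominates p w in go c (t ≟ a) (t ≟ b) (t ≟ x) (t ≟ m x)
      where
      go : ∀ {t} → Covers m t w → Dec (t ≡ a) → Dec (t ≡ b) → Dec (t ≡ x) → Dec (t ≡ m x) →
           ∃[ s ] Covers m′ s w
      go (_ , w∼a , w∼b) (yes refl) _ _ _ = via-ax w∼a w∼b
      go (_ , w∼b , w∼mb) _ (yes refl) _ _ = via-ax (subst (w ∼_) (involutive p a) w∼mb) w∼b
      go (mx≢x , w∼x , w∼mx) _ _ (yes refl) _ = via-bx′ mx≢x w∼x w∼mx
      go (_ , w∼mx , w∼mmx) _ _ (no t≢x) (yes refl) =
        via-bx′ t≢x (subst (w ∼_) (involutive p x) w∼mmx) w∼mx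
      go {t} c (no t≢a) (no t≢b) (no t≢x) (no t≢mx) =
        t , subst (λ s → s ≢ t × w ∼ t × w ∼ s) (sym (m′-other t≢a t≢b t≢x t≢mx)) c

  -- The vertex w shows that x reaches beyond b, the obstacle to exchanging
  -- {a, b}, {x, mate x} for {a, x}, {b, mate x}.
  record Blocked (O : IntervalOrder) (p : Pairing) (a b : V) : Set where
    open IntervalOrder O
    field
      {x w}     : V
      essential : Essential p a b x
      x≺mate    : x ≺ mate p x
      w∼x       : w ∼ x
      b≺w       : b ≺ w

  -- Blocked exchanges and the walk along them

  module _ (O : IntervalOrder) (p : Pairing) where
    open IntervalOrder O

    -- Only a common neighbour `w` of `x` and its mate that misses `b` can spoil the exchange. It
    -- cannot lie left of `b`, since `interchange` would then put `x` left of `b` or `w` left of the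
    -- mate.
    exchange-or-blocked : ∀ {a b x} →
                          mate p a ≡ b → a ≺ b → Essential p a b x → x ≺ mate p x →
                          Improvement p ⊎ Blocked O p a b
    exchange-or-blocked {a} {b} {x} refl a≺b e@(x∼a , x∼b , _) x≺mx
      with any? (λ w → (w ∼? x) ×-dec (w ∼? mate p x) ×-dec ¬? (w ∼? b))
    ... | no none = inj₁ (exchange p (≺⇒≁ a≺b) x∼a x∼b (inj₂ (≺⇒≁ x≺mx)) (between a≺b x∼a x∼b)
        λ {w} _ w∼x w∼mx → decidable-stable (w ∼? b) λ w≁b → none (w , w∼x , w∼mx , w≁b))
    ... | yes (w , w∼x , w∼mx , w≁b) = inj₂ record
        { essential = e ; x≺mate = x≺mx ; w∼x = w∼x ; b≺w = b≺w (≁⇒≺⊎≻ w≁b) }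
      where
      b≺w : w ≺ b ⊎ b ≺ w → b ≺ w
      b≺w (inj₂ b≺w) = b≺w
      b≺w (inj₁ w≺b) with interchange x≺mx w≺b
      ... | inj₁ x≺b  = contradiction x∼b (≺⇒≁ x≺b)
      ... | inj₂ w≺mx = contradiction w∼mx (≺⇒≁ w≺mx)

  module _ (O : IntervalOrder) (p : Pairing) where
    open IntervalOrder O

    improve-or-blocked : ∀ {a b} → mate p a ≡ b → a ≺ b →
                         Improvement p ⊎ Blocked O p a b ⊎ Blocked (opposite O) p b a
    improve-or-blocked {a} {b} refl a≺b with any? (essential? p a b)
    ... | no none = inj₁ (drop-pair p (≺⇒≁ a≺b) λ w e → none (w , e))
    ... | yes (x , e@(x∼a , x∼b , only)) with mate p x ≟ x | x ∼? mate p x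
    ...   | yes mx≡x | _ = inj₁ (exchange p (≺⇒≁ a≺b) x∼a x∼b (inj₁ mx≡x) (between a≺b x∼a x∼b)
        λ mx≢x → contradiction mx≡x mx≢x)
    -- An adjacent pair containing `x` would cover `x` itself, so `x` would be `a` or `b`; but `x`
    -- meets both, and they are not adjacent.
    ...   | no mx≢x | yes x∼mx = ⊥-elim ([ (λ { refl → ≺⇒≁ a≺b x∼b }) , (λ { refl → ≺⇒≁′ a≺b x∼a }) ]′
        (only x (mx≢x , ∼-refl , x∼mx)))
    ...   | no _ | no x≁mx with ≁⇒≺⊎≻ x≁mx
    ...     | inj₁ x≺mx = [ inj₁ , inj₂ ∘ inj₁ ]′ (exchange-or-blocked O p refl a≺b e x≺mx)
    ...     | inj₂ mx≺x = [ inj₁ , inj₂ ∘ inj₂ ]′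
        (exchange-or-blocked (opposite O) p (involutive p a) a≺b (x∼b , x∼a , λ t → swap ∘ only t) mx≺x)

    -- Once a blocked pair {c, d} has led to the right, to {a, b}, the latter
    -- cannot be blocked on the left: the blocking vertex would be covered by
    -- {c, d}. So the walk keeps moving to the right and ends.
    walk : ∀ {a b c d} → Acc (flip _≺_) b →
           mate p a ≡ b → a ≺ b → mate p c ≡ d → c ≺ d → a ∼ c → a ∼ d → Improvement p
    walk {a} {b} {c} {d} (acc rec) ma≡b a≺b mc≡d c≺d a∼c a∼d
      with improve-or-blocked ma≡b a≺b
    ... | inj₁ better = better
    ... | inj₂ (inj₁ blocked) = walk (rec b≺mx) refl x≺mate ma≡b a≺b x∼a x∼b
      where
      open Blocked blocked
      x∼a = proj₁ essential
      x∼b = proj₁ (proj₂ essential)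
      -- The right end of the current pair advances, which is what the induction descends on.
      b≺mx : b ≺ mate p x
      b≺mx with interchange x≺mate b≺w
      ... | inj₁ x≺w  = contradiction w∼x (≺⇒≁′ x≺w)
      ... | inj₂ b≺mx = b≺mx
    ... | inj₂ (inj₂ blocked) = ⊥-elim
        -- If `c` were `a` or `b`, then `a` would meet `b`, as it meets both `c` and `d`.
        ([ (λ { refl → ≺⇒≁ a≺b a∼c })
         , (λ { refl → ≺⇒≁ a≺b (subst (a ∼_) (trans (sym mc≡d) ma≡b) a∼d) })
         ]′ (only c ((λ mc≡c → ≺⇒≢ c≺d (trans (sym mc≡c) mc≡d))
                    , reaches a∼c , subst (x ∼_) (sym mc≡d) (reaches a∼d))))
      where
      open Blocked blocked
      only = proj₂ (proj₂ essential)
      -- Here `x` extends from the left of `a` up to `b`, so it meets whatever `a` meets, in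
      -- particular `c` and `d`.
      reaches : ∀ {v} → a ∼ v → x ∼ v
      reaches = absorb a≺b (proj₁ essential) b≺w w∼x

  module _ (O : IntervalOrder) (p : Pairing) where
    open IntervalOrder O

    -- The side of the first blockage fixes the direction of the walk; a blockage on the left is
    -- walked in the opposite order.
    improve-ordered : ∀ {a b} → mate p a ≡ b → a ≺ b → Improvement p
    improve-ordered ma≡b a≺b with improve-or-blocked O p ma≡b a≺b
    ... | inj₁ better = better
    ... | inj₂ (inj₁ blocked) = walk O p (≺-noetherian _) refl x≺mate ma≡b a≺b
        (proj₁ essential) (proj₁ (proj₂ essential))
      where open Blocked blocked
    ... | inj₂ (inj₂ blocked) = walk (opposite O) p (IntervalOrder.≺-noetherian (opposite O) _) refl x≺mate
        (mate-≡ p ma≡b) a≺b (proj₁ essential) (proj₁ (proj₂ essential))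
      where open Blocked blocked

  -- Iterating improvements

  improve : IntervalOrder → ∀ p {a} → Nonadjacent p a → Improvement p
  improve O p a≁ma with IntervalOrder.≁⇒≺⊎≻ O a≁ma
  ... | inj₁ a≺ma = improve-ordered O p refl a≺ma
  ... | inj₂ ma≺a = improve-ordered (opposite O) p refl ma≺a

  -- The induction is on a set `S` that merely contains the nonadjacent vertices, so one may start
  -- from all vertices and delete one per improvement.
  adjacent-pairing : IntervalOrder → Pairing → ∃[ p ] (∀ t → t ∼ mate p t)
  adjacent-pairing O p = go (⊂-wellFounded ⊤) p λ _ → ∈⊤
    where
    go : ∀ {S : Subset order} → Acc _⊂_ S → ∀ p → (∀ {t} → Nonadjacent p t → t ∈ˢ S) →
         ∃[ p ] (∀ t → t ∼ mate p t)
    go (acc rec) p bad⊆S with any? (λ t → ¬? (t ∼? mate p t))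
    ... | no none = p , λ t → decidable-stable (t ∼? mate p t) λ bad → none (t , bad)
    ... | yes (_ , bad) with improve O p bad
    ...   | p′ , bad′⊆bad , a , a≁ma , a∼m′a = go (rec (x∈p⇒p-x⊂p (bad⊆S a≁ma))) p′
      λ bad′ → x∈p∧x≢y⇒x∈p-y (bad⊆S (bad′⊆bad bad′)) λ { refl → bad′ a∼m′a }

  -- Translation between pairing dominating sets and involutions

  module _ (D : PairingDominatingSet G) where
    open PairingDominatingSet D

    private
      End : Set
      End = Fin size ⊎ Fin size

      vertex : End → V
      vertex = [ left , right ]′

      End? : ∀ v → Dec (∃[ e ] vertex e ≡ v)
      End? v = map′
        [ (λ (i , eq) → inj₁ i , eq) , (λ (i , eq) → inj₂ i , eq) ]′
        (λ { (inj₁ i , eq) → inj₁ (i , eq) ; (inj₂ i , eq) → inj₂ (i , eq) })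
        (any? (λ i → left i ≟ v) ⊎-dec any? (λ i → right i ≟ v))

      partner : V → V
      partner v with End? v
      ... | yes (e , _) = vertex (swap e)
      ... | no _        = v

      partner-vertex : ∀ e → partner (vertex e) ≡ vertex (swap e)
      partner-vertex e with End? (vertex e)
      ... | yes (e′ , eq) = cong (vertex ∘ swap) (distinct {e′} {e} eq)
      ... | no none       = contradiction (e , refl) none

      partner-involutive : ∀ v → partner (partner v) ≡ v
      partner-involutive v with End? v
      ... | yes (e , refl) = trans (partner-vertex (swap e)) (cong vertex (swap-involutive e))
      ... | no none with End? v
      ...   | yes end = contradiction end none
      ...   | no _    = refl

    fromPairingDominatingSet : Pairing
    fromPairingDominatingSet = record
      { mate = partner ; involutive = partner-involutive ; dominates = dominates′ }
      where
      dominates′ : ∀ w → ∃[ t ] Covers partner t w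
      dominates′ w with dominating w
      ... | i , w∼l , w∼r = left i ,
        subst (λ s → s ≢ left i × w ∼ left i × w ∼ s) (sym (partner-vertex (inj₁ i)))
          ((λ r≡l → case distinct {inj₂ i} {inj₁ i} r≡l of λ ()) , ∼-sym w∼l , ∼-sym w∼r)

  toPairingDominatingSet : ∀ p → (∀ t → t ∼ mate p t) → ∃ (HasAdjacentPairs G)
  toPairingDominatingSet p adjacent = record
    { size = length lefts ; left = l ; right = m ∘ l
    ; distinct = distinct′ _ _ ; dominating = dominating′ } ,
    λ i → [ (λ ml≡l → contradiction (sym ml≡l) (<⇒≢ (l<ml i))) , (λ adj → adj) ]′ (adjacent (l i))
    where
    m = mate p
    -- Each pair is listed once, through its smaller vertex; fixed points drop out.
    first? : ∀ v → Dec (v < m v)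
    first? v = v <? m v
    lefts : List V
    lefts = filter first? (allFin order)
    l : Fin (length lefts) → V
    l = lookup lefts
    l-injective : ∀ i j → l i ≡ l j → i ≡ j
    l-injective = lookup-injective (filter⁺ first? (allFin⁺ order))
    l<ml : ∀ i → l i < m (l i)
    l<ml i = proj₂ (∈-filter⁻ first? {xs = allFin order} (∈-lookup i))
    l≢ml : ∀ i j → l i ≢ m (l j)
    l≢ml i j eq = <-asym (l<ml j) (subst₂ _<_ eq (mate-≡ p (sym eq)) (l<ml i))
    distinct′ : ∀ e f → [ l , m ∘ l ]′ e ≡ [ l , m ∘ l ]′ f → e ≡ f
    distinct′ (inj₁ i) (inj₁ j) eq = cong inj₁ (l-injective i j eq)
    distinct′ (inj₁ i) (inj₂ j) eq = contradiction eq (l≢ml i j)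
    distinct′ (inj₂ i) (inj₁ j) eq = contradiction (sym eq) (l≢ml j i)
    distinct′ (inj₂ i) (inj₂ j) eq = cong inj₂ (l-injective i j (mate-injective p eq))
    dominate : ∀ {t w} → t < m t → w ∼ t → w ∼ m t → ∃[ i ] l i ∼ w × m (l i) ∼ w
    dominate {t} {w} t<mt w∼t w∼mt =
      index t∈ , subst (λ s → s ∼ w × m s ∼ w) (lookup-index t∈) (∼-sym w∼t , ∼-sym w∼mt)
      where
      t∈ : t ∈ᴸ lefts
      t∈ = ∈-filter⁺ first? (∈-allFin t) t<mt
    dominating′ : ∀ w → ∃[ i ] l i ∼ w × m (l i) ∼ w
    dominating′ w with dominates p w
    ... | t , mt≢t , w∼t , w∼mt with <-cmp t (m t)
    ...   | tri< t<mt _ _ = dominate t<mt w∼t w∼mt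
    ...   | tri≈ _ t≡mt _ = contradiction (sym t≡mt) mt≢t
    ...   | tri> _ _ mt<t = dominate (subst (m t <_) (sym (involutive p t)) mt<t) w∼mt
      (subst (w ∼_) (sym (involutive p t)) w∼t)

-- Comparison of cuts and finite double negation

≰ᴿ⇒≥ᴿ : ∀ {x y} → ¬ x ≤ᴿ y → y ≤ᴿ x
≰ᴿ⇒≥ᴿ {x} {y} x≰y {q} q∈Ly with Equivalence.to (ℝ.L-rounded y q) q∈Ly
... | r , q<r , r∈Ly with ℝ.located x q r q<r
...   | inj₁ q∈Lx = q∈Lx
-- Now `r` lies above `x` and below `y`, so `x ≤ᴿ y` after all.
...   | inj₂ r∈Ux = ⊥-elim (x≰y x≤y)
  where
  x≤y : x ≤ᴿ y
  x≤y {s} s∈Lx with <ℚ-cmp s r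
  ... | tri< s<r _ _  = Equivalence.from (ℝ.L-rounded y s) (r , s<r , r∈Ly)
  ... | tri≈ _ refl _ = r∈Ly
  ... | tri> _ _ r<s  = contradiction (Equivalence.from (ℝ.L-rounded x r) (s , r<s , s∈Lx) , r∈Ux)
    (ℝ.disjoint x r)

-- Double negation commutes with finite products.
¬¬-decidable : ∀ {n} (P : Fin n → Set) → ¬ ¬ (∀ i → Dec (P i))
¬¬-decidable P = sequence (RawMonad.rawApplicative ¬¬-Monad) λ i → ¬¬-excluded-middle

comprehension : ∀ {n} {P : Fin n → Set} → (∀ i → Dec (P i)) →
                ∃[ S ] (∀ i → (P i → i ∈ˢ S) × (i ∈ˢ S → P i))
comprehension {n} {P} P? = S , λ i → P⇒∈ i , ∈⇒P i
  where
  S : Subset n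
  S = tabulate (does ∘ P?)
  P⇒∈ : ∀ i → P i → i ∈ˢ S
  P⇒∈ i pi = lookup⇒[]= i S (trans (lookup∘tabulate _ i) (dec-true (P? i) pi))
  ∈⇒P : ∀ i → i ∈ˢ S → P i
  ∈⇒P i i∈S with P? i | trans (sym (lookup∘tabulate (does ∘ P?) i)) ([]=⇒lookup i∈S)
  ... | yes pi | _ = pi

-- An interval order from the real intervals

module _ (G : Graph) (interval : IsIntervalGraph G) where
  open Graph G
  open module Interval v = ClosedInterval (proj₁ interval v)

  private
    adj⇔meet = proj₂ interval

  ∼⇒≤ : ∀ {u v} → _∼_ G u v → lo v ≤ᴿ hi u
  ∼⇒≤ {u} (inj₁ refl) = lo≤hi u
  ∼⇒≤ {u} {v} (inj₂ uv) with Equivalence.to (adj⇔meet u v (λ u≡v → Adj-irrefl u≡v uv)) uv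
  ... | _ , (_ , x≤hi-u) , (lo-v≤x , _) = x≤hi-u ∘ lo-v≤x

  -- The larger left endpoint is a common point. Which one is larger is undecidable, so each is
  -- refuted in turn under the assumption `u≁v`.
  ≤⇒∼ : ∀ {u v} → lo v ≤ᴿ hi u → lo u ≤ᴿ hi v → _∼_ G u v
  ≤⇒∼ {u} {v} lo-v≤hi-u lo-u≤hi-v = decidable-stable (_∼?_ G u v) λ u≁v →
    let meet⇒⊥ = λ meet → u≁v (inj₂ (Equivalence.from (adj⇔meet u v (λ u≡v → u≁v (inj₁ (sym u≡v)))) meet))
        lo-u≰lo-v = λ (lo-u≤lo-v : lo u ≤ᴿ lo v) →
          meet⇒⊥ (lo v , (lo-u≤lo-v , lo-v≤hi-u) , ((λ q → q) , lo≤hi v))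
    in meet⇒⊥ (lo u , ((λ q → q) , lo≤hi u) , (≰ᴿ⇒≥ᴿ {lo u} {lo v} lo-u≰lo-v , lo-u≤hi-v))

  -- Coding a relation as a finite subset of pairs makes the search over all relations finite.
  Left : Subset (order ℕ* order) → Rel V 0ℓ
  Left S u v = combine u v ∈ˢ S

  IsOrder : Subset (order ℕ* order) → Set
  IsOrder S = (∀ u v → Left S u v → ¬ _∼_ G u v)
            × (∀ u v → ¬ _∼_ G u v → Left S u v ⊎ Left S v u)
            × (∀ a b c d → Left S a b → Left S c d → Left S a d ⊎ Left S c b)

  isOrder? : ∀ S → Dec (IsOrder S)
  isOrder? S =
          (all? λ u → all? λ v → left? u v →-dec ¬? (_∼?_ G u v))
    ×-dec (all? λ u → all? λ v → ¬? (_∼?_ G u v) →-dec (left? u v ⊎-dec left? v u))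
    ×-dec (all? λ a → all? λ b → all? λ c → all? λ d →
             left? a b →-dec (left? c d →-dec (left? a d ⊎-dec left? c b)))
    where
    left? : Decidable (Left S)
    left? u v = combine u v ∈? S

  private
    Precedes : V → V → Set
    Precedes u v = ¬ lo v ≤ᴿ hi u

    Precedes′ : Fin (order ℕ* order) → Set
    Precedes′ k = let u , v = remQuot order k in Precedes u v

    -- The actual order of the intervals is a witness once it is decidable. This is known only under
    -- double negation, which suffices because `IsOrder` is decidable.
    order-exists : (∀ k → Dec (Precedes′ k)) → ∃ IsOrder
    order-exists dec with comprehension dec
    ... | S , char = S ,
        (λ u v uv u∼v → to uv (∼⇒≤ u∼v)) ,
        (λ u v u≁v → separate u v u≁v) ,
        λ a b c d ab cd → interchange′ (to ab) (to cd)
      where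
      from : ∀ {u v} → Precedes u v → Left S u v
      from {u} {v} uv = proj₁ (char _) (subst (λ (u , v) → Precedes u v) (sym (remQuot-combine u v)) uv)
      to : ∀ {u v} → Left S u v → Precedes u v
      to {u} {v} uv = subst (λ (u , v) → Precedes u v) (remQuot-combine u v) (proj₂ (char _) uv)
      precedes? : ∀ u v → Dec (Precedes u v)
      precedes? u v = map′ to from (combine u v ∈? S)
      separate : ∀ u v → ¬ _∼_ G u v → Left S u v ⊎ Left S v u
      separate u v u≁v with precedes? u v
      ... | yes uv = inj₁ (from uv)
      ... | no ¬uv = inj₂ (from λ lo-u≤hi-v → ¬uv λ lo-v≤hi-u → u≁v (≤⇒∼ lo-v≤hi-u lo-u≤hi-v))
      interchange′ : ∀ {a b c d} → Precedes a b → Precedes c d → Left S a d ⊎ Left S c b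
      interchange′ {a} {b} {c} {d} ab cd with precedes? a d
      ... | yes ad = inj₁ (from ad)
      -- Otherwise `lo b ≤ hi c ≤ lo d ≤ hi a`, contrary to `ab`.
      ... | no ¬ad = inj₂ (from λ lo-b≤hi-c → ¬ad λ lo-d≤hi-a →
        ab (lo-d≤hi-a ∘ ≰ᴿ⇒≥ᴿ {lo d} {hi c} cd ∘ lo-b≤hi-c))

  -- The order of the real endpoints is not decidable, but a suitable order of
  -- the vertices can be found by exhaustive search.
  intervalOrder : IntervalOrder G
  intervalOrder with decidable-stable (anySubset? isOrder?) (¬¬-map order-exists (¬¬-decidable Precedes′))
  ... | S , ≺⇒≁ , ≁⇒≺⊎≻ , interchange = record
    { _≺_         = Left S
    ; ≺⇒≁         = λ {u} {v} → ≺⇒≁ u v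
    ; ≁⇒≺⊎≻       = λ {u} {v} → ≁⇒≺⊎≻ u v
    ; interchange = λ {a} {b} {c} {d} → interchange a b c d
    }

proposition4p4 : (G : Graph) → IsIntervalGraph G → PairingDominatingSet G → ∃ (HasAdjacentPairs G)
proposition4p4 G interval D =
  let p , adjacent = adjacent-pairing G (intervalOrder G interval) (fromPairingDominatingSet G D)
  in toPairingDominatingSet G p adjacent
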